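{- Let $H$ be a homogeneous relation on a finite set $V$. Define $s:\mathcal P(V)\to\mathbb R$ by $s(X)=|\mathcal S_X|$ for nonempty $X\subseteq V$ and $s(\emptyset)=-|V|$. Then $s$ is submodular: for all $X,Y\subseteq V$, $s(X)+s(Y)\ge s(X\cup Y)+s(X\cap Y)$.
   Context: $V$ is a finite set and $\mathcal P(V)$ its power set. A reflectless triple is a triple $(x,y,z)\in V^3$ with $x\neq y$ and $x\neq z$, written $(x|yz)$. A homogeneous relation $H$ on $V$ is a set of reflectless triples (we write $H(s|xy)$ when $(s|xy)\in H$) such that for every $s\in V$ the binary relation $H_s=\{(x,y): H(s|xy)\}$ is an equivalence relation on $V\setminus\{s\}$. For $X\subseteq V$ and $z\in V\setminus X$, $z$ distinguishes (splits) $X$ if there exist $x,y\in X$ with not $H(z|xy)$. $\mathcal S_X$ denotes the set of all elements of $V\setminus X$ distinguishing $X$. -}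

module Defs where

open import Level using (Level; suc)
open import Data.Nat.Base using (ℕ)
open import Data.Integer.Base using (ℤ; +_; -_; _+_; _≥_)
open import Data.Fin.Base using (Fin)
open import Data.Fin.Properties using (any?)
open import Data.Fin.Subset using (Subset; _∈_; _∉_; _∪_; _∩_; ∣_∣)
open import Data.Fin.Subset.Properties using (_∈?_; nonempty?)
open import Data.Product.Base using (∃; ∃₂; _×_; proj₁)
open import Data.Vec.Base using (tabulate)
open import Function.Base using (_on_)
open import Relation.Binary.Core using (Rel)
open import Relation.Binary.Definitions using (Decidable)
open import Relation.Binary.Structures using (IsEquivalence)
open import Relation.Binary.PropositionalEquality.Core using (_≢_)
open import Relation.Nullary.Decidable.Core using (yes; no; does; ¬?; _×-dec_)
open import Relation.Nullary.Negation.Core using (¬_)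

private variable
  ℓ : Level
  n : ℕ

_∖_ : (A : Set ℓ) → A → Set ℓ
A ∖ s = ∃ λ (x : A) → x ≢ s

-- The finite set V is Fin n.  H s x y stands for H(s|xy), so H s is the binary
-- relation H_s.  Decidability, automatic classically for a set of triples over
-- a finite set, is what makes the set of splitters of X a Subset n.
record HomogeneousRelation (n : ℕ) (ℓ : Level) : Set (suc ℓ) where
  field
    H             : Fin n → Rel (Fin n) ℓ
    H?            : ∀ s → Decidable (H s)
    reflectless   : ∀ {s x y} → H s x y → s ≢ x × s ≢ y
    isEquivalence : ∀ s → IsEquivalence {A = Fin n ∖ s} (H s on proj₁)

module _ (R : HomogeneousRelation n ℓ) where
  open HomogeneousRelation R

  Distinguishes : Fin n → Subset n → Set ℓ
  Distinguishes z X = z ∉ X × ∃₂ λ x y → x ∈ X × y ∈ X × ¬ H z x y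

  distinguishes? : Decidable Distinguishes
  distinguishes? z X = ¬? (z ∈? X) ×-dec
    any? λ x → any? λ y → (x ∈? X) ×-dec (y ∈? X) ×-dec ¬? (H? z x y)

  splitters : Subset n → Subset n
  splitters X = tabulate λ z → does (distinguishes? z X)

  s : Subset n → ℤ
  s X with nonempty? X
  ... | yes _ = + ∣ splitters X ∣
  ... | no  _ = - (+ n)

Submodular : (Subset n → ℤ) → Set
Submodular f = ∀ X Y → f X + f Y ≥ f (X ∪ Y) + f (X ∩ Y)

{-# OPTIONS --safe #-}

-- The union of S_{X∪Y} and S_{X∩Y} lies in S_X ∪ S_Y and their intersection in
-- S_X ∩ S_Y, provided X ∩ Y contains some w: an element outside X ∪ Y
-- that splits neither X nor Y relates every element of X ∪ Y to w.
-- By modularity of cardinality this is the inequality when X and Y meet.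
-- When they are disjoint and nonempty, s(X ∩ Y) = -|V| absorbs s(X ∪ Y) ≤ |V|.
module Submission where

open import Level using (Level)
open import Data.Bool.Base using (true; false)
open import Data.Fin.Subset
  using (Subset; _∈_; _∉_; _⊆_; _∪_; _∩_; ⊥; ∣_∣; Nonempty; Empty)
open import Data.Fin.Subset.Properties
open import Data.Integer.Base as ℤ using (+_; -_; +≤+)
import Data.Integer.Properties as ℤ
open import Data.Nat.Base as ℕ using (ℕ; suc; _≤_; z≤n)
import Data.Nat.Properties as ℕ
open import Data.Product.Base using (_,_)
open import Data.Sum.Base as Sum using (_⊎_; inj₁; inj₂; [_,_])
open import Data.Vec.Base using ([]; _∷_)
open import Data.Vec.Properties using (lookup∘tabulate; lookup⇒[]=; []=⇒lookup)
open import Function.Base using (_∘_; case_of_)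
open import Relation.Binary.PropositionalEquality
  using (_≡_; refl; sym; trans; cong; cong₂; subst₂; ≢-sym; module ≡-Reasoning)
open import Relation.Binary.Structures using (IsEquivalence)
open import Relation.Nullary.Decidable using (Dec; yes; no; dec-true; dec-false; decidable-stable)
open import Relation.Nullary.Negation using (¬_; contradiction)
open import Defs

private variable
  ℓ : Level
  n : ℕ

∣p∪q∣+∣p∩q∣≡∣p∣+∣q∣ : (p q : Subset n) → ∣ p ∪ q ∣ ℕ.+ ∣ p ∩ q ∣ ≡ ∣ p ∣ ℕ.+ ∣ q ∣
∣p∪q∣+∣p∩q∣≡∣p∣+∣q∣ []          []          = refl
∣p∪q∣+∣p∩q∣≡∣p∣+∣q∣ (false ∷ p) (false ∷ q) = ∣p∪q∣+∣p∩q∣≡∣p∣+∣q∣ p q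
∣p∪q∣+∣p∩q∣≡∣p∣+∣q∣ (true  ∷ p) (false ∷ q) = cong suc (∣p∪q∣+∣p∩q∣≡∣p∣+∣q∣ p q)
∣p∪q∣+∣p∩q∣≡∣p∣+∣q∣ (false ∷ p) (true  ∷ q) =
  trans (cong suc (∣p∪q∣+∣p∩q∣≡∣p∣+∣q∣ p q)) (sym (ℕ.+-suc ∣ p ∣ ∣ q ∣))
∣p∪q∣+∣p∩q∣≡∣p∣+∣q∣ (true  ∷ p) (true  ∷ q) = cong suc (begin
  ∣ p ∪ q ∣ ℕ.+ suc ∣ p ∩ q ∣    ≡⟨ ℕ.+-suc ∣ p ∪ q ∣ ∣ p ∩ q ∣ ⟩
  suc (∣ p ∪ q ∣ ℕ.+ ∣ p ∩ q ∣)  ≡⟨ cong suc (∣p∪q∣+∣p∩q∣≡∣p∣+∣q∣ p q) ⟩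
  suc (∣ p ∣ ℕ.+ ∣ q ∣)          ≡⟨ ℕ.+-suc ∣ p ∣ ∣ q ∣ ⟨
  ∣ p ∣ ℕ.+ suc ∣ q ∣            ∎)
  where open ≡-Reasoning

-- Modularity rewrites each sum as union plus intersection, and each inclusion then bounds one
-- summand. This reduces the counting to membership arguments.
∣p∣+∣q∣-mono : (p q p′ q′ : Subset n) → p ∪ q ⊆ p′ ∪ q′ → p ∩ q ⊆ p′ ∩ q′ →
               ∣ p ∣ ℕ.+ ∣ q ∣ ≤ ∣ p′ ∣ ℕ.+ ∣ q′ ∣
∣p∣+∣q∣-mono p q p′ q′ ∪⊆∪ ∩⊆∩ =
  subst₂ _≤_ (∣p∪q∣+∣p∩q∣≡∣p∣+∣q∣ p q) (∣p∪q∣+∣p∩q∣≡∣p∣+∣q∣ p′ q′)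
    (ℕ.+-mono-≤ (p⊆q⇒∣p∣≤∣q∣ ∪⊆∪) (p⊆q⇒∣p∣≤∣q∣ ∩⊆∩))

module _ (R : HomogeneousRelation n ℓ) where
  open HomogeneousRelation R

  -- `s` branches on `nonempty?` and does not reduce from a mere proof of `Nonempty X`; this lemma
  -- and `s-empty` select the branch.
  s-nonempty : ∀ {X} → Nonempty X → s R X ≡ + ∣ splitters R X ∣
  s-nonempty {X} ne with nonempty? X
  ... | yes _     = refl
  ... | no  empty = contradiction ne empty

  s-empty : ∀ {X} → Empty X → s R X ≡ - (+ n)
  s-empty {X} empty with nonempty? X
  ... | yes ne = contradiction ne empty
  ... | no  _  = refl

  ∈splitters⁺ : ∀ {z X} → Distinguishes R z X → z ∈ splitters R X
  ∈splitters⁺ {z} {X} d = lookup⇒[]= z _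
    (trans (lookup∘tabulate _ z) (dec-true (distinguishes? R z X) d))

  ∈splitters⁻ : ∀ {z X} → z ∈ splitters R X → Distinguishes R z X
  ∈splitters⁻ {z} {X} z∈ = decidable-stable d? λ ¬d →
    -- If `z` did not distinguish `X`, its tabulated bit would be both `false` and `true`.
    case trans (sym (dec-false d? ¬d)) (trans (sym (lookup∘tabulate _ z)) ([]=⇒lookup z∈)) of λ ()
    where d? = distinguishes? R z X

  distinguishes-mono : ∀ {z X Y} → X ⊆ Y → z ∉ Y → Distinguishes R z X → Distinguishes R z Y
  distinguishes-mono X⊆Y z∉Y (_ , x , y , x∈X , y∈X , ¬xy) = z∉Y , x , y , X⊆Y x∈X , X⊆Y y∈X , ¬xy

  -- `H z` is an equivalence only away from `z`, and `reflectless` shows that the points involved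
  -- differ from `z`. The points are passed explicitly because `_on_ proj₁` forgets these proofs, so
  -- unification cannot recover them.
  H-sym : ∀ {z x y} → H z x y → H z y x
  H-sym {z} h = let z≢x , z≢y = reflectless h in
    IsEquivalence.sym (isEquivalence z) {_ , ≢-sym z≢x} {_ , ≢-sym z≢y} h

  H-trans : ∀ {z x y w} → H z x y → H z y w → H z x w
  H-trans {z} h k = let z≢x , z≢y = reflectless h; _ , z≢w = reflectless k in
    IsEquivalence.trans (isEquivalence z)
      {_ , ≢-sym z≢x} {_ , ≢-sym z≢y} {_ , ≢-sym z≢w} h k

  ¬distinguishes⇒H : ∀ {z X x y} → z ∉ X → ¬ Distinguishes R z X → x ∈ X → y ∈ X → H z x y
  ¬distinguishes⇒H {z} {x = x} {y} z∉X ¬d x∈X y∈X =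
    decidable-stable (H? z x y) λ ¬xy → ¬d (z∉X , x , y , x∈X , y∈X , ¬xy)

  distinguishes-∪ : ∀ {z X Y} → Nonempty (X ∩ Y) → Distinguishes R z (X ∪ Y) →
                    Distinguishes R z X ⊎ Distinguishes R z Y
  distinguishes-∪ {z} {X} {Y} (w , w∈X∩Y) (z∉X∪Y , x , y , x∈ , y∈ , ¬xy)
    with distinguishes? R z X | distinguishes? R z Y
  ... | yes dX | _      = inj₁ dX
  ... | no  _  | yes dY = inj₂ dY
  -- `x` and `y` may lie in different sets; the common element `w` links them.
  ... | no ¬dX | no ¬dY = contradiction (H-trans (H-w x∈) (H-sym (H-w y∈))) ¬xy
    where
    H-w : ∀ {v} → v ∈ X ∪ Y → H z v w
    H-w v∈ = let w∈X , w∈Y = x∈p∩q⁻ X Y w∈X∩Y in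
      [ (λ v∈X → ¬distinguishes⇒H (z∉X∪Y ∘ p⊆p∪q Y) ¬dX v∈X w∈X)
      , (λ v∈Y → ¬distinguishes⇒H (z∉X∪Y ∘ q⊆p∪q X Y) ¬dY v∈Y w∈Y)
      ] (x∈p∪q⁻ X Y v∈)

  -- Being outside the intersection, `z` misses one of the two sets, and that set contains the same
  -- separated pair.
  distinguishes-∩ : ∀ {z X Y} → Distinguishes R z (X ∩ Y) →
                    Distinguishes R z X ⊎ Distinguishes R z Y
  distinguishes-∩ {z} {X} {Y} d@(z∉X∩Y , _) with z ∈? X | z ∈? Y
  ... | no z∉X  | _       = inj₁ (distinguishes-mono (p∩q⊆p X Y) z∉X d)
  ... | yes _   | no z∉Y  = inj₂ (distinguishes-mono (p∩q⊆q X Y) z∉Y d)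
  ... | yes z∈X | yes z∈Y = contradiction (x∈p∩q⁺ (z∈X , z∈Y)) z∉X∩Y

  splitters-submodular : ∀ X Y → Nonempty (X ∩ Y) →
    ∣ splitters R (X ∪ Y) ∣ ℕ.+ ∣ splitters R (X ∩ Y) ∣ ≤ ∣ splitters R X ∣ ℕ.+ ∣ splitters R Y ∣
  splitters-submodular X Y X∩Y≢∅ = ∣p∣+∣q∣-mono S∪ S∩ (splitters R X) (splitters R Y)
    (λ z∈ → x∈p∪q⁺ (Sum.map ∈splitters⁺ ∈splitters⁺
      ([ distinguishes-∪ X∩Y≢∅ ∘ ∈splitters⁻ , distinguishes-∩ ∘ ∈splitters⁻ ] (x∈p∪q⁻ S∪ S∩ z∈))))
    -- Splitting the union places `z` outside both sets; splitting the intersection supplies a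
    -- separated pair that lies in both.
    (λ z∈ → let z∈S∪ , z∈S∩ = x∈p∩q⁻ S∪ S∩ z∈
                z∉X∪Y , _   = ∈splitters⁻ z∈S∪
                d           = ∈splitters⁻ z∈S∩
            in x∈p∩q⁺ ( ∈splitters⁺ (distinguishes-mono (p∩q⊆p X Y) (z∉X∪Y ∘ p⊆p∪q Y) d)
                      , ∈splitters⁺ (distinguishes-mono (p∩q⊆q X Y) (z∉X∪Y ∘ q⊆p∪q X Y) d)))
    where
    S∪ = splitters R (X ∪ Y)
    S∩ = splitters R (X ∩ Y)

  -- The union is `Y` and the intersection is empty, so the two sides add the same values in
  -- opposite order.
  s-modular-∅ : ∀ X Y → Empty X → s R X ℤ.+ s R Y ≡ s R (X ∪ Y) ℤ.+ s R (X ∩ Y)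
  s-modular-∅ X Y X≡∅ rewrite Empty-unique X≡∅ | ∪-identityˡ Y | ∩-zeroˡ Y =
    ℤ.+-comm (s R ⊥) (s R Y)

mainTheorem6 : ∀ {ℓ : Level} (n : ℕ) (R : HomogeneousRelation n ℓ) → Submodular (s R)
mainTheorem6 n R X Y = by-cases (nonempty? X) (nonempty? Y) (nonempty? (X ∩ Y))
  where
  by-cases : Dec (Nonempty X) → Dec (Nonempty Y) → Dec (Nonempty (X ∩ Y)) →
             s R (X ∪ Y) ℤ.+ s R (X ∩ Y) ℤ.≤ s R X ℤ.+ s R Y
  by-cases (no X≡∅) _ _ = ℤ.≤-reflexive (sym (s-modular-∅ R X Y X≡∅))
  by-cases (yes _) (no Y≡∅) _ = ℤ.≤-reflexive (begin
    s R (X ∪ Y) ℤ.+ s R (X ∩ Y)  ≡⟨ cong₂ (λ U I → s R U ℤ.+ s R I) (∪-comm X Y) (∩-comm X Y) ⟩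
    s R (Y ∪ X) ℤ.+ s R (Y ∩ X)  ≡⟨ s-modular-∅ R Y X Y≡∅ ⟨
    s R Y ℤ.+ s R X              ≡⟨ ℤ.+-comm (s R Y) (s R X) ⟩
    s R X ℤ.+ s R Y              ∎)
    where open ≡-Reasoning
  by-cases (yes (x , x∈X)) (yes Y≢∅) (no X∩Y≡∅) = begin
    s R (X ∪ Y) ℤ.+ s R (X ∩ Y)
      ≡⟨ cong₂ ℤ._+_ (s-nonempty R (x , p⊆p∪q Y x∈X)) (s-empty R X∩Y≡∅) ⟩
    + ∣ splitters R (X ∪ Y) ∣ ℤ.- + n
      -- Zero separates the sides: at most `n` splitters on the left, a sum of cardinalities on the
      -- right.
      ≤⟨ ℤ.i≤j⇒i-j≤0 (+≤+ (∣p∣≤n (splitters R (X ∪ Y)))) ⟩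
    + 0
      ≤⟨ +≤+ z≤n ⟩
    + ∣ splitters R X ∣ ℤ.+ + ∣ splitters R Y ∣
      ≡⟨ cong₂ ℤ._+_ (s-nonempty R (x , x∈X)) (s-nonempty R Y≢∅) ⟨
    s R X ℤ.+ s R Y ∎
    where open ℤ.≤-Reasoning
  by-cases (yes X≢∅@(x , x∈X)) (yes Y≢∅) (yes X∩Y≢∅) = begin
    s R (X ∪ Y) ℤ.+ s R (X ∩ Y)
      ≡⟨ cong₂ ℤ._+_ (s-nonempty R (x , p⊆p∪q Y x∈X)) (s-nonempty R X∩Y≢∅) ⟩
    + ∣ splitters R (X ∪ Y) ∣ ℤ.+ + ∣ splitters R (X ∩ Y) ∣
      -- Integer addition of two `+_` terms computes to `+_` of the natural sum, so the inequality
      -- lifts directly.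
      ≤⟨ +≤+ (splitters-submodular R X Y X∩Y≢∅) ⟩
    + ∣ splitters R X ∣ ℤ.+ + ∣ splitters R Y ∣
      ≡⟨ cong₂ ℤ._+_ (s-nonempty R X≢∅) (s-nonempty R Y≢∅) ⟨
    s R X ℤ.+ s R Y ∎
    where open ℤ.≤-Reasoning
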